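{- Let $\mathscr{A}$, $(\mathcal{E},\mathcal{M})$, $\mathscr{A}_0$, $\Lambda$, $\mathscr{X}$ be data satisfying the standing assumptions listed in the context. A class $\mathcal{V}\subseteq\mathscr{A}_0$ is equationally presentable if and only if it forms a variety.
   Context: A factorization system $(\mathcal{E},\mathcal{M})$ in a category consists of two classes of morphisms, both containing all isomorphisms and closed under composition, such that every morphism $f$ factorizes as $f=m\cdot e$ with $e\in\mathcal{E}$, $m\in\mathcal{M}$, and the unique diagonal fill-in property holds. It is proper if all $\mathcal{E}$-morphisms are epic and all $\mathcal{M}$-morphisms are monic. Fix a category $\mathscr{A}$ with a proper factorization system $(\mathcal{E},\mathcal{M})$, a full subcategory $\mathscr{A}_0\subseteq\mathscr{A}$, a class $\Lambda$ of cardinal numbers and a class $\mathscr{X}$ of objects of $\mathscr{A}$. A quotient of $X$ is represented by an $\mathcal{E}$-morphism with domain $X$; quotients of $X$ are ordered by $e\leq e'$ iff $e'=h\cdot e$ for some $h$, and isomorphic quotients are identified. $X{\downarrow}\mathscr{A}_0$ denotes the class of quotients of $X$ with codomain in $\mathscr{A}_0$. An object $X$ is projective w.r.t. $e\colon A\to B$ if every $h\colon X\to B$ is of the form $e\cdot g$ for some $g\colon X\to A$. Put $\mathcal{E}_{\mathscr{X}}=\{e\in\mathcal{E}: \text{every } X\in\mathscr{X} \text{ is projective w.r.t. } e\}$. An object is $\mathscr{X}$-generated if it is a quotient of an object of $\mathscr{X}$. Standing assumptions: (1) $\mathscr{A}$ has $\Lambda$-products, i.e. products of families $(A_i)_{i<\lambda}$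 with $\lambda\in\Lambda$. (2) $\mathscr{A}_0$ is closed under isomorphisms, $\Lambda$-products and $\mathscr{X}$-generated subobjects (if $m\colon A\to B$ is in $\mathcal{M}$, $B\in\mathscr{A}_0$ and $A$ is $\mathscr{X}$-generated, then $A\in\mathscr{A}_0$). (3) For every $A\in\mathscr{A}_0$ there is some $e\colon X\to A$ in $\mathcal{E}_{\mathscr{X}}$ with $X\in\mathscr{X}$. An equation over $X\in\mathscr{X}$ is a class $\mathscr{T}_X\subseteq X{\downarrow}\mathscr{A}_0$ that is (i) $\Lambda$-codirected: every subset $F\subseteq\mathscr{T}_X$ with $|F|\in\Lambda$ has a lower bound in $\mathscr{T}_X$; (ii) closed under $\mathcal{E}_{\mathscr{X}}$-quotients: for $e\colon X\to E$ in $\mathscr{T}_X$ and $q\colon E\to E'$ in $\mathcal{E}_{\mathscr{X}}$ with $E'\in\mathscr{A}_0$, one has $q\cdot e\in\mathscr{T}_X$. An object $A$ satisfies $\mathscr{T}_X$ (written $A\models\mathscr{T}_X$) if every $h\colon X\to A$ factorizes through some $e\in\mathscr{T}_X$. For a class $\mathbb{E}$ of equations (over possibly different objects of $\mathscr{X}$) put $\mathcal{V}(\mathbb{E})=\{A\in\mathscr{A}_0: A\models\mathscr{T}_X\text{ for each }\mathscr{T}_X\in\mathbb{E}\}$. A class $\mathcal{V}\subseteq\mathscr{A}_0$ is equationally presentable if $\mathcal{V}=\mathcal{V}(\mathbb{E})$ for some class $\mathbb{E}$ of equations. A variety is a full subcategory $\mathcal{V}\subseteq\mathscr{A}_0$ such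 that: if $e\colon A\to B$ is in $\mathcal{E}_{\mathscr{X}}$ with $A\in\mathcal{V}$, $B\in\mathscr{A}_0$, then $B\in\mathcal{V}$; if $m\colon A\to B$ is in $\mathcal{M}$ with $A\in\mathscr{A}_0$, $B\in\mathcal{V}$, then $A\in\mathcal{V}$; products of families $(A_i)_{i<\lambda}$ in $\mathcal{V}$ with $\lambda\in\Lambda$ lie in $\mathcal{V}$.
   Formalization: Λ-codirectedness is required for families of members of the equation indexed by a cardinal in Λ, repetitions allowed, not for subsets F with |F| in Λ; with exact subsets the claim fails, e.g. for Λ = {3} and the meet-semilattice {a, b, a∧b}. -}

module Defs where

open import Level using (Level; suc; _⊔_)
open import Data.Product using (Σ-syntax; ∃!; _×_; proj₁)
open import Function.Bundles using (_↔_)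
open import Relation.Binary.Structures using (IsEquivalence)
open import Relation.Unary using (Pred; _∈_; _⊆_; _≐_)

-- Hom-sets are setoids, so every class of morphisms below is required to
-- respect _≈_.
record Category (o ℓ e : Level) : Set (suc (o ⊔ ℓ ⊔ e)) where
  infixr 9 _∘_
  infix  4 _≈_ _⇒_
  field
    Obj : Set o
    _⇒_ : Obj → Obj → Set ℓ
    _≈_ : ∀ {A B} → A ⇒ B → A ⇒ B → Set e
    id  : ∀ {A} → A ⇒ A
    _∘_ : ∀ {A B C} → B ⇒ C → A ⇒ B → A ⇒ C

    ≈-equiv   : ∀ {A B} → IsEquivalence (_≈_ {A} {B})
    ∘-resp-≈  : ∀ {A B C} {f f′ : B ⇒ C} {g g′ : A ⇒ B} →
                f ≈ f′ → g ≈ g′ → f ∘ g ≈ f′ ∘ g′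
    assoc     : ∀ {A B C D} {f : A ⇒ B} {g : B ⇒ C} {h : C ⇒ D} →
                (h ∘ g) ∘ f ≈ h ∘ (g ∘ f)
    identityˡ : ∀ {A B} {f : A ⇒ B} → id ∘ f ≈ f
    identityʳ : ∀ {A B} {f : A ⇒ B} → f ∘ id ≈ f

module _ {o ℓ e : Level} (𝒜 : Category o ℓ e) where
  open Category 𝒜

  IsIso : ∀ {A B} → A ⇒ B → Set (ℓ ⊔ e)
  IsIso {A} {B} f = Σ[ g ∈ B ⇒ A ] (g ∘ f ≈ id × f ∘ g ≈ id)

  Isomorphic : Obj → Obj → Set (ℓ ⊔ e)
  Isomorphic A B = Σ[ f ∈ A ⇒ B ] IsIso f

  Epic : ∀ {A B} → A ⇒ B → Set (o ⊔ ℓ ⊔ e)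
  Epic {A} {B} f = ∀ {C} (g h : B ⇒ C) → g ∘ f ≈ h ∘ f → g ≈ h

  Monic : ∀ {A B} → A ⇒ B → Set (o ⊔ ℓ ⊔ e)
  Monic {A} {B} f = ∀ {C} (g h : C ⇒ A) → f ∘ g ≈ f ∘ h → g ≈ h

  IsProduct : ∀ {ι} {I : Set ι} (A : I → Obj) (P : Obj) →
              (∀ i → P ⇒ A i) → Set (o ⊔ ℓ ⊔ e ⊔ ι)
  IsProduct A P π = ∀ {B} (f : ∀ i → B ⇒ A i) →
    ∃! _≈_ λ (h : B ⇒ P) → ∀ i → π i ∘ h ≈ f i

  record ProperFactorizationSystem (c : Level) : Set (o ⊔ ℓ ⊔ e ⊔ suc c) where
    field
      𝓔 : ∀ {A B} → Pred (A ⇒ B) c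
      𝓜 : ∀ {A B} → Pred (A ⇒ B) c

      𝓔-resp-≈ : ∀ {A B} {f g : A ⇒ B} → f ≈ g → f ∈ 𝓔 → g ∈ 𝓔
      𝓜-resp-≈ : ∀ {A B} {f g : A ⇒ B} → f ≈ g → f ∈ 𝓜 → g ∈ 𝓜
      𝓔-iso    : ∀ {A B} {f : A ⇒ B} → IsIso f → f ∈ 𝓔
      𝓜-iso    : ∀ {A B} {f : A ⇒ B} → IsIso f → f ∈ 𝓜
      𝓔-∘      : ∀ {A B C} {g : B ⇒ C} {f : A ⇒ B} → g ∈ 𝓔 → f ∈ 𝓔 → g ∘ f ∈ 𝓔
      𝓜-∘      : ∀ {A B C} {g : B ⇒ C} {f : A ⇒ B} → g ∈ 𝓜 → f ∈ 𝓜 → g ∘ f ∈ 𝓜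

      factorize : ∀ {A B} (f : A ⇒ B) →
        Σ[ C ∈ Obj ] Σ[ q ∈ A ⇒ C ] Σ[ m ∈ C ⇒ B ]
          (q ∈ 𝓔 × m ∈ 𝓜 × f ≈ m ∘ q)

      diagonal : ∀ {A B C D} {q : A ⇒ B} {m : C ⇒ D} → q ∈ 𝓔 → m ∈ 𝓜 →
        (f : A ⇒ C) (g : B ⇒ D) → m ∘ f ≈ g ∘ q →
        ∃! _≈_ λ (d : B ⇒ C) → d ∘ q ≈ f × m ∘ d ≈ g

      𝓔-epic  : ∀ {A B} {f : A ⇒ B} → f ∈ 𝓔 → Epic f
      𝓜-monic : ∀ {A B} {f : A ⇒ B} → f ∈ 𝓜 → Monic f

-- A cardinal is a set up to bijection; I ∈ Card says that the cardinality of I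
-- lies in the class.  Families (Aᵢ)_{i<λ} are then families over such an I.
record CardinalClass (ι c : Level) : Set (suc (ι ⊔ c)) where
  field
    Card   : Pred (Set ι) c
    Card-↔ : ∀ {I J} → I ↔ J → I ∈ Card → J ∈ Card

-- Classes are predicates, all valued in the one universe Set c.
record Setting (o ℓ e ι c : Level) : Set (suc (o ⊔ ℓ ⊔ e ⊔ ι ⊔ c)) where
  field
    𝒜  : Category o ℓ e
    FS : ProperFactorizationSystem 𝒜 c
  open Category 𝒜 public
  open ProperFactorizationSystem FS public
  field
    A₀ : Pred Obj c
    Λ  : CardinalClass ι c
    𝒳  : Pred Obj c
  open CardinalClass Λ public

module _ {o ℓ e ι c : Level} (S : Setting o ℓ e ι c) where
  open Setting S

  record Quotient (X : Obj) : Set (o ⊔ ℓ ⊔ c) where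
    field
      cod   : Obj
      arr   : X ⇒ cod
      arr∈𝓔 : arr ∈ 𝓔
  open Quotient

  _≤Q_ : ∀ {X} → Quotient X → Quotient X → Set (ℓ ⊔ e)
  q ≤Q q′ = Σ[ h ∈ cod q ⇒ cod q′ ] arr q′ ≈ h ∘ arr q

  _≅Q_ : ∀ {X} → Quotient X → Quotient X → Set (ℓ ⊔ e)
  q ≅Q q′ = Σ[ h ∈ cod q ⇒ cod q′ ] (IsIso 𝒜 h × arr q′ ≈ h ∘ arr q)

  Projective : Obj → ∀ {A B} → A ⇒ B → Set (ℓ ⊔ e)
  Projective X {A} {B} q = (h : X ⇒ B) → Σ[ g ∈ X ⇒ A ] h ≈ q ∘ g

  𝓔𝒳 : ∀ {A B} → Pred (A ⇒ B) (o ⊔ ℓ ⊔ e ⊔ c)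
  𝓔𝒳 q = q ∈ 𝓔 × (∀ {X} → X ∈ 𝒳 → Projective X q)

  Generated : Pred Obj (o ⊔ ℓ ⊔ c)
  Generated A = Σ[ X ∈ Obj ] (X ∈ 𝒳 × (Σ[ q ∈ X ⇒ A ] q ∈ 𝓔))

  record StandingAssumptions : Set (suc ι ⊔ o ⊔ ℓ ⊔ e ⊔ c) where
    field
      Λ-products : ∀ {I : Set ι} → I ∈ Card → (A : I → Obj) →
        Σ[ P ∈ Obj ] Σ[ π ∈ (∀ i → P ⇒ A i) ] IsProduct 𝒜 A P π

      A₀-iso : ∀ {A B} → Isomorphic 𝒜 A B → A ∈ A₀ → B ∈ A₀
      A₀-products : ∀ {I : Set ι} → I ∈ Card →
        {A : I → Obj} {P : Obj} {π : ∀ i → P ⇒ A i} →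
        IsProduct 𝒜 A P π → (∀ i → A i ∈ A₀) → P ∈ A₀
      A₀-subobjects : ∀ {A B} {m : A ⇒ B} →
        m ∈ 𝓜 → B ∈ A₀ → A ∈ Generated → A ∈ A₀

      enough-𝒳 : ∀ {A} → A ∈ A₀ →
        Σ[ X ∈ Obj ] (X ∈ 𝒳 × (Σ[ q ∈ X ⇒ A ] q ∈ 𝓔𝒳))

  record Equation : Set (suc (ι ⊔ c) ⊔ o ⊔ ℓ ⊔ e) where
    field
      X   : Obj
      X∈𝒳 : X ∈ 𝒳
      T   : Pred (Quotient X) c
      -- isomorphic quotients are identified
      T-≅ : ∀ {q q′} → q ≅Q q′ → q ∈ T → q′ ∈ T
      T⊆  : ∀ {q} → q ∈ T → cod q ∈ A₀

      -- A subset F of T with |F| ∈ Λ is given by an enumeration q of it by some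
      -- I with |I| ∈ Λ, and, as for families of objects, the members qᵢ need not
      -- be distinct.  This only differs from requiring distinct members when Λ
      -- is not closed under smaller nonzero cardinals.  With Λ = {3}, distinct
      -- members would let a pair of incomparable quotients be an equation, and
      -- the objects satisfying it need not be closed under products: take the
      -- meet-semilattice {a, b, a ∧ b} with 𝓔 = all morphisms, 𝓜 = isomorphisms,
      -- all objects in A₀ and 𝒳, and T = {a, b} over X = a ∧ b.
      Λ-codirected : ∀ {I : Set ι} → I ∈ Card →
        (q : I → Quotient X) → (∀ i → q i ∈ T) →
        Σ[ p ∈ Quotient X ] (p ∈ T × (∀ i → p ≤Q q i))

      𝓔𝒳-closed : ∀ {q} → q ∈ T → ∀ {E′} {r : cod q ⇒ E′} (r∈ : r ∈ 𝓔𝒳) →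
        E′ ∈ A₀ →
        record { cod = E′ ; arr = r ∘ arr q ; arr∈𝓔 = 𝓔-∘ (proj₁ r∈) (arr∈𝓔 q) } ∈ T

  _⊨_ : Obj → Equation → Set (o ⊔ ℓ ⊔ e ⊔ c)
  A ⊨ eq = (h : X ⇒ A) →
    Σ[ q ∈ Quotient X ] (q ∈ T × (Σ[ g ∈ cod q ⇒ A ] h ≈ g ∘ arr q))
    where open Equation eq

  𝒱 : ∀ {k} → Pred Equation k → Pred Obj (suc (ι ⊔ c) ⊔ o ⊔ ℓ ⊔ e ⊔ k)
  𝒱 𝔼 A = A ∈ A₀ × (∀ (eq : Equation) → eq ∈ 𝔼 → A ⊨ eq)

  EquationallyPresentable : Pred Obj c → Set (suc (o ⊔ ℓ ⊔ e ⊔ ι ⊔ c))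
  EquationallyPresentable V =
    Σ[ 𝔼 ∈ Pred Equation (o ⊔ ℓ ⊔ e ⊔ c) ] V ≐ 𝒱 𝔼

  record IsVariety (V : Pred Obj c) : Set (suc ι ⊔ o ⊔ ℓ ⊔ e ⊔ c) where
    field
      quotients : ∀ {A B} {q : A ⇒ B} → q ∈ 𝓔𝒳 → A ∈ V → B ∈ A₀ → B ∈ V
      subobjects : ∀ {A B} {m : A ⇒ B} → m ∈ 𝓜 → A ∈ A₀ → B ∈ V → A ∈ V
      products : ∀ {I : Set ι} → I ∈ Card →
        {A : I → Obj} {P : Obj} {π : ∀ i → P ⇒ A i} →
        IsProduct 𝒜 A P π → (∀ i → A i ∈ V) → P ∈ V

{-# OPTIONS --safe #-}
-- An equation is satisfied by A when every morphism into A factorizes through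
-- it.  Such factorizations lift along 𝓔𝒳-morphisms by projectivity, restrict
-- along 𝓜-morphisms by diagonal fill-in, and combine in a Λ-product by
-- Λ-codirectedness.  Conversely, for a variety V the quotients of X with
-- codomain in V form an equation: a lower bound of (qᵢ) is the 𝓔-part of the
-- induced morphism into the product of their codomains.  If A satisfies all of
-- these equations, factorize some X → A in 𝓔𝒳 as g ∘ q with q in the equation
-- over X; then g is in 𝓔𝒳 and exhibits A as a quotient of a member of V.
module Submission where

open import Defs
open import Data.Product using (Σ-syntax; _×_; _,_; proj₁; proj₂)
open import Level using (Level; _⊔_)
open import Function.Bundles using (_⇔_; mk⇔)
open import Relation.Binary.Bundles using (Setoid)
open import Relation.Binary.Structures using (IsEquivalence)
import Relation.Binary.Reasoning.Setoid as SetoidReasoning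
open import Relation.Unary using (Pred; _∈_; _⊆_)

module CategoryProperties {o ℓ e : Level} (𝒜 : Category o ℓ e) where
  open Category 𝒜

  module ≈ {A B : Obj} = IsEquivalence (≈-equiv {A} {B})

  homSetoid : Obj → Obj → Setoid ℓ e
  homSetoid A B = record { Carrier = A ⇒ B ; _≈_ = _≈_ ; isEquivalence = ≈-equiv }

  module HomReasoning {A B : Obj} = SetoidReasoning (homSetoid A B)
  open HomReasoning

  pullˡ : ∀ {A B C D} {f : C ⇒ D} {g : B ⇒ C} {k : B ⇒ D} {h : A ⇒ B} →
    f ∘ g ≈ k → f ∘ (g ∘ h) ≈ k ∘ h
  pullˡ fg≈k = ≈.trans (≈.sym assoc) (∘-resp-≈ fg≈k ≈.refl)

  monic-retraction⇒iso : ∀ {A B} {m : A ⇒ B} {s : B ⇒ A} →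
    Monic 𝒜 m → m ∘ s ≈ id → IsIso 𝒜 m
  monic-retraction⇒iso {m = m} {s} mono ms≈id = s , mono (s ∘ m) id (begin
    m ∘ (s ∘ m)  ≈⟨ pullˡ ms≈id ⟩
    id ∘ m       ≈⟨ identityˡ ⟩
    m            ≈⟨ identityʳ ⟨
    m ∘ id       ∎) , ms≈id

  IsProduct-jointlyMonic : ∀ {ι} {I : Set ι} {A : I → Obj} {P : Obj}
    {π : ∀ i → P ⇒ A i} → IsProduct 𝒜 A P π →
    ∀ {B} {f g : B ⇒ P} → (∀ i → π i ∘ f ≈ π i ∘ g) → f ≈ g
  IsProduct-jointlyMonic {π = π} prod {g = g} πf≈πg =
    let _ , _ , unique = prod (λ i → π i ∘ g)
    in ≈.trans (≈.sym (unique πf≈πg)) (unique (λ _ → ≈.refl))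

module SettingProperties {o ℓ e ι c : Level} (S : Setting o ℓ e ι c) where
  open Setting S
  open CategoryProperties 𝒜
  open HomReasoning
  open Quotient

  -- With `m ∘ q` the factorization of `g`, the fill-in `d` of the square
  -- `m ∘ (q ∘ f) ≈ id ∘ (g ∘ f)` is a right inverse of the monic `m`. So `m` is an isomorphism, and
  -- `g` lies in `𝓔` together with `q`.
  𝓔-cancelʳ : ∀ {A B C} {g : B ⇒ C} {f : A ⇒ B} → g ∘ f ∈ 𝓔 → g ∈ 𝓔
  𝓔-cancelʳ {g = g} {f} gf∈𝓔 =
    let _ , q , m , q∈𝓔 , m∈𝓜 , g≈mq = factorize g
        square = begin
          m ∘ (q ∘ f)   ≈⟨ pullˡ (≈.sym g≈mq) ⟩
          g ∘ f         ≈⟨ identityˡ ⟨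
          id ∘ (g ∘ f)  ∎
        _ , (_ , md≈id) , _ = diagonal gf∈𝓔 m∈𝓜 (q ∘ f) id square
        m-iso = monic-retraction⇒iso (𝓜-monic m∈𝓜) md≈id
    in 𝓔-resp-≈ (≈.sym g≈mq) (𝓔-∘ (𝓔-iso m-iso) q∈𝓔)

  Projective-cancelʳ : ∀ {X A B C} {g : B ⇒ C} {f : A ⇒ B} →
    Projective S X (g ∘ f) → Projective S X g
  Projective-cancelʳ {f = f} proj h =
    let k , h≈gfk = proj h
    in f ∘ k , ≈.trans h≈gfk assoc

  Projective-resp-≈ : ∀ {X A B} {f g : A ⇒ B} →
    f ≈ g → Projective S X f → Projective S X g
  Projective-resp-≈ f≈g proj h =
    let k , h≈fk = proj h
    in k , ≈.trans h≈fk (∘-resp-≈ f≈g ≈.refl)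

  𝓔𝒳-resp-≈ : ∀ {A B} {f g : A ⇒ B} → f ≈ g → 𝓔𝒳 S f → 𝓔𝒳 S g
  𝓔𝒳-resp-≈ f≈g (f∈𝓔 , proj) =
    𝓔-resp-≈ f≈g f∈𝓔 , λ X∈𝒳 → Projective-resp-≈ f≈g (proj X∈𝒳)

  -- A lift along `g ∘ f`, followed by `f`, is a lift along `g`. This later turns a projective cover
  -- of an object by some `X ∈ 𝒳` into one by a member of the variety.
  𝓔𝒳-cancelʳ : ∀ {A B C} {g : B ⇒ C} {f : A ⇒ B} → 𝓔𝒳 S (g ∘ f) → 𝓔𝒳 S g
  𝓔𝒳-cancelʳ (gf∈𝓔 , proj) =
    𝓔-cancelʳ gf∈𝓔 , λ X∈𝒳 → Projective-cancelʳ (proj X∈𝒳)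

  module _ (eq : Equation S) where
    open Equation eq

    ⊨-quotient : ∀ {A B} {r : A ⇒ B} → 𝓔𝒳 S r → _⊨_ S A eq → _⊨_ S B eq
    ⊨-quotient {r = r} (_ , proj) A⊨ h =
      let k , h≈rk = proj X∈𝒳 h
          q , q∈T , g , k≈gq = A⊨ k
      in q , q∈T , r ∘ g , (begin
        h                ≈⟨ h≈rk ⟩
        r ∘ k            ≈⟨ ∘-resp-≈ ≈.refl k≈gq ⟩
        r ∘ (g ∘ arr q)  ≈⟨ assoc ⟨
        (r ∘ g) ∘ arr q  ∎)

    ⊨-subobject : ∀ {A B} {m : A ⇒ B} → m ∈ 𝓜 → _⊨_ S B eq → _⊨_ S A eq
    ⊨-subobject {m = m} m∈𝓜 B⊨ h =
      let q , q∈T , g , mh≈gq = B⊨ (m ∘ h)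
          d , (dq≈h , _) , _ = diagonal (arr∈𝓔 q) m∈𝓜 h g mh≈gq
      in q , q∈T , d , ≈.sym dq≈h

    ⊨-product : ∀ {I : Set ι} → I ∈ Card → {A : I → Obj} {P : Obj}
      {π : ∀ i → P ⇒ A i} → IsProduct 𝒜 A P π →
      (∀ i → _⊨_ S (A i) eq) → _⊨_ S P eq
    ⊨-product {I} I∈Λ {A} {π = π} prod A⊨ h = p , p∈T , t ,
      IsProduct-jointlyMonic prod λ i → begin
        π i ∘ h                ≈⟨ πh≈gq i ⟩
        g i ∘ arr (q i)        ≈⟨ ∘-resp-≈ ≈.refl (proj₂ (p≤q i)) ⟩
        g i ∘ (k i ∘ arr p)    ≈⟨ assoc ⟨
        (g i ∘ k i) ∘ arr p    ≈⟨ ∘-resp-≈ (πt≈gk i) ≈.refl ⟨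
        (π i ∘ t) ∘ arr p      ≈⟨ assoc ⟩
        π i ∘ (t ∘ arr p)      ∎
      where
      q : I → Quotient S X
      q i = proj₁ (A⊨ i (π i ∘ h))

      g : ∀ i → cod (q i) ⇒ A i
      g i = proj₁ (proj₂ (proj₂ (A⊨ i (π i ∘ h))))

      πh≈gq : ∀ i → π i ∘ h ≈ g i ∘ arr (q i)
      πh≈gq i = proj₂ (proj₂ (proj₂ (A⊨ i (π i ∘ h))))

      -- The quotient `q i` varies with the component; a lower bound replaces all of them by a
      -- single `p`.
      lowerBound : Σ[ p ∈ Quotient S X ] (p ∈ T × (∀ i → _≤Q_ S p (q i)))
      lowerBound = Λ-codirected I∈Λ q (λ i → proj₁ (proj₂ (A⊨ i (π i ∘ h))))

      p = proj₁ lowerBound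
      p∈T = proj₁ (proj₂ lowerBound)
      p≤q = proj₂ (proj₂ lowerBound)

      k : ∀ i → cod p ⇒ cod (q i)
      k i = proj₁ (p≤q i)

      -- Precomposed with `k i`, the maps `g i` share the domain `cod p` and therefore induce one
      -- map into `P`.
      mediating = prod (λ i → g i ∘ k i)
      t = proj₁ mediating
      πt≈gk = proj₁ (proj₂ mediating)

module _ {o ℓ e ι c : Level} (S : Setting o ℓ e ι c)
  (SA : StandingAssumptions S) where
  open Setting S
  open StandingAssumptions SA
  open CategoryProperties 𝒜
  open HomReasoning
  open SettingProperties S
  open Quotient

  presentable⇒variety : {V : Pred Obj c} →
    EquationallyPresentable S V → IsVariety S V
  presentable⇒variety (𝔼 , V⊆𝒱 , 𝒱⊆V) = record
    { quotients  = λ r∈𝓔𝒳 A∈V B∈A₀ → 𝒱⊆V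
        (B∈A₀ , λ eq eq∈𝔼 → ⊨-quotient eq r∈𝓔𝒳 (proj₂ (V⊆𝒱 A∈V) eq eq∈𝔼))
    ; subobjects = λ m∈𝓜 A∈A₀ B∈V → 𝒱⊆V
        (A∈A₀ , λ eq eq∈𝔼 → ⊨-subobject eq m∈𝓜 (proj₂ (V⊆𝒱 B∈V) eq eq∈𝔼))
    ; products   = λ I∈Λ prod A∈V → 𝒱⊆V
        ( A₀-products I∈Λ prod (λ i → proj₁ (V⊆𝒱 (A∈V i)))
        , λ eq eq∈𝔼 → ⊨-product eq I∈Λ prod (λ i → proj₂ (V⊆𝒱 (A∈V i)) eq eq∈𝔼))
    }

  module _ {V : Pred Obj c} (V⊆A₀ : V ⊆ A₀) (isVariety : IsVariety S V) where
    open IsVariety isVariety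

    -- The inverse isomorphism is in `𝓜` and exhibits `B` as a subobject of `A`.
    V-iso : ∀ {A B} → Isomorphic 𝒜 A B → A ∈ V → B ∈ V
    V-iso A≅B@(f , f⁻¹ , f⁻¹f≈id , ff⁻¹≈id) A∈V =
      subobjects (𝓜-iso (f , ff⁻¹≈id , f⁻¹f≈id)) (A₀-iso A≅B (V⊆A₀ A∈V)) A∈V

    -- Closure of `V` under subobjects applies only inside `A₀`. The image of `h` is a quotient of
    -- `X ∈ 𝒳`, hence generated, so `A₀-subobjects` places it there.
    V-image : ∀ {X B} → X ∈ 𝒳 → B ∈ V → (h : X ⇒ B) →
      Σ[ q ∈ Quotient S X ] (cod q ∈ V × (Σ[ m ∈ cod q ⇒ B ] h ≈ m ∘ arr q))
    V-image {X} X∈𝒳 B∈V h =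
      let C , q , m , q∈𝓔 , m∈𝓜 , h≈mq = factorize h
          C∈A₀ = A₀-subobjects m∈𝓜 (V⊆A₀ B∈V) (X , X∈𝒳 , q , q∈𝓔)
      in record { cod = C ; arr = q ; arr∈𝓔 = q∈𝓔 }
         , subobjects m∈𝓜 C∈A₀ B∈V , m , h≈mq

    V-lowerBound : ∀ {X} → X ∈ 𝒳 → {I : Set ι} → I ∈ Card →
      (q : I → Quotient S X) → (∀ i → cod (q i) ∈ V) →
      Σ[ p ∈ Quotient S X ] (cod p ∈ V × (∀ i → _≤Q_ S p (q i)))
    V-lowerBound X∈𝒳 I∈Λ q q∈V =
      let P , π , prod = Λ-products I∈Λ (λ i → cod (q i))
          h , πh≈q , _ = prod (λ i → arr (q i))
          -- `P` need not be a quotient of `X`, but the image of `h` is one, and the projections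
          -- restrict to it along `m`.
          p , p∈V , m , h≈mp = V-image X∈𝒳 (products I∈Λ prod q∈V) h
      in p , p∈V , λ i → π i ∘ m , (begin
        arr (q i)          ≈⟨ πh≈q i ⟨
        π i ∘ h            ≈⟨ ∘-resp-≈ ≈.refl h≈mp ⟩
        π i ∘ (m ∘ arr p)  ≈⟨ assoc ⟨
        (π i ∘ m) ∘ arr p  ∎)

    equationOver : ∀ {X} → X ∈ 𝒳 → Equation S
    equationOver {X} X∈𝒳 = record
      { X            = X
      ; X∈𝒳          = X∈𝒳
      ; T            = λ q → cod q ∈ V
      ; T-≅          = λ (h , h-iso , _) → V-iso (h , h-iso)
      ; T⊆           = V⊆A₀
      ; Λ-codirected = V-lowerBound X∈𝒳
      ; 𝓔𝒳-closed    = λ q∈T r∈𝓔𝒳 E′∈A₀ → quotients r∈𝓔𝒳 q∈T E′∈A₀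
      }

    -- The class {equationOver X∈𝒳 : X ∈ 𝒳} would live in a universe too large
    -- for EquationallyPresentable, since it refers to equality of equations.
    validEquations : Pred (Equation S) (o ⊔ ℓ ⊔ e ⊔ c)
    validEquations eq = ∀ {A} → A ∈ V → _⊨_ S A eq

    equationOver-valid : ∀ {X} (X∈𝒳 : X ∈ 𝒳) → equationOver X∈𝒳 ∈ validEquations
    equationOver-valid X∈𝒳 A∈V = V-image X∈𝒳 A∈V

    ⊨-equationOver⇒∈V : ∀ {A} → A ∈ A₀ →
      (∀ {X} (X∈𝒳 : X ∈ 𝒳) → _⊨_ S A (equationOver X∈𝒳)) → A ∈ V
    ⊨-equationOver⇒∈V A∈A₀ A⊨ =
      let _ , X∈𝒳 , r , r∈𝓔𝒳 = enough-𝒳 A∈A₀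
          _ , q∈V , _ , r≈gq = A⊨ X∈𝒳 r
      in quotients (𝓔𝒳-cancelʳ (𝓔𝒳-resp-≈ r≈gq r∈𝓔𝒳)) q∈V A∈A₀

    variety⇒presentable : EquationallyPresentable S V
    variety⇒presentable =
        validEquations
      , (λ A∈V → V⊆A₀ A∈V , λ _ valid → valid A∈V)
      -- Every `equationOver X∈𝒳` is among the valid equations, and together these already force
      -- membership in `V`.
      , (λ (A∈A₀ , A⊨) → ⊨-equationOver⇒∈V A∈A₀
          λ X∈𝒳 → A⊨ (equationOver X∈𝒳) (equationOver-valid X∈𝒳))

theorem3p16 : ∀ {o ℓ e ι c : Level} (S : Setting o ℓ e ι c) →
    StandingAssumptions S →
    (V : Pred (Setting.Obj S) c) → V ⊆ Setting.A₀ S →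
    EquationallyPresentable S V ⇔ IsVariety S V
theorem3p16 S SA V V⊆A₀ =
  mk⇔ (presentable⇒variety S SA) (variety⇒presentable S SA V⊆A₀)
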